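{- Let $(\mathcal{R},\oplus,\leqslant)$ be a lattice ordered monoid with neutral element $0$ whose lattice is conditionally complete, let $D=(V,A)$ be a finite digraph with $o,d\in V$, let $(x_a)_{a\in A}\in\mathcal{R}^A$, and let $c:\mathcal{R}\to\mathbb{R}$ and $\rho:\mathcal{R}\to\{0,1\}$ be isotone. Suppose that every cycle $C$ in $D$ satisfies $x_C\geqslant 0$. Then the label dominance algorithm terminates after a finite number of iterations, and at the end, if $c_{od}^{UB}$ is finite, then $c_{od}^{UB}$ is the cost of a non-dominated optimal solution of the Monoid Resource Constrained Shortest Path Problem; otherwise, the problem admits no feasible solution.
   Context: A lattice ordered monoid $(\mathcal{R},\oplus,\leqslant)$ is a monoid $(\mathcal{R},\oplus)$ (associative, with neutral element $0$, possibly non-commutative) with a partial order $\leqslant$ that is a lattice order and is such that all translations $y\mapsto x\oplus y$ and $y\mapsto y\oplus x$ are isotone (order-preserving). Conditionally complete: every nonempty bounded subset has a meet and a join. Paths are finite sequences of arcs, the head of each being the tail of the next; vertices and arcs may be repeated, and empty paths (one at each vertex, with resource $0$) are allowed. A cycle is a nonempty path whose origin equals its destination. The resource of a path $P=(a_1,\dots,a_k)$ is $x_P=x_{a_1}\oplus\cdots\oplus x_{a_k}$. $P$ is feasible if $\rho(x_P)=0$; its cost is $c(x_P)$. The Monoid Resource Constrained Shortest Path Problem asks for a feasible $o$-$d$ path of minimum cost; an optimal solution is such a path. An $o$-$v$ path $P$ dominates an $o$-$v$ path $\tilde P$ if $x_P\leqslant x_{\tilde P}$. An optimal solution $P$ is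 called non-dominated if there is no $o$-$d$ path $Q$ with $x_Q<x_P$. Label dominance algorithm: maintain a list $L$ of paths with origin $o$, a value $c_{od}^{UB}\in\mathbb{R}\cup\{+\infty\}$, and for each vertex $v$ a list $M_v$ of $o$-$v$ paths. Initially $L$ contains only the empty path at $o$, $c_{od}^{UB}=+\infty$, and all $M_v$ are empty. While $L$ is nonempty, repeat: (1) extract (remove) from $L$ a path $P$, with destination denoted $v$, of minimum key $c(x_P)$ among the paths of $L$ (ties broken arbitrarily); (2) if $v=d$, $\rho(x_P)=0$ and $c(x_P)<c_{od}^{UB}$, then set $c_{od}^{UB}:=c(x_P)$; (3) else, if the dominance test "no path in $M_v$ dominates $P$" holds, then remove from $M_v$ and $L$ all the paths of $M_v$ dominated by $P$, add $P$ to $M_v$, and extend $P$: for each arc $a$ outgoing from $v$, add $P+a$ ($P$ followed by $a$) to $L$. -}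

module Defs where

open import Level using (Level; _⊔_; 0ℓ) renaming (suc to lsuc)
open import Algebra.Core using (Op₂)
open import Algebra.Structures using (IsMonoid)
open import Data.Empty using (⊥)
open import Data.Fin.Base using (Fin; zero)
open import Data.Fin.Properties using (_≟_)
open import Data.List.Base using (List; []; _∷_; [_]; _++_; map; filter; mapMaybe; allFin)
open import Data.List.Membership.Propositional using (_∈_)
open import Data.List.Relation.Unary.All using (All)
open import Data.List.Relation.Unary.Any using (Any; _─_)
import Data.Maybe.Base as Maybe
open import Data.Nat.Base using (ℕ)
open import Data.Product.Base using (∃; _×_; _,_; proj₁)
open import Data.Rational.Base as ℚ using (ℚ)
open import Data.Sum.Base using (_⊎_)
open import Relation.Binary.Construct.Closure.ReflexiveTransitive using (Star; ε; _◅_; _◅◅_)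
import Relation.Binary.Construct.Add.Supremum.Strict as AddSupremum
import Relation.Binary.Construct.NonStrictToStrict as ToStrict
open import Relation.Binary.Core using (Rel; _Preserves_⟶_)
open import Relation.Binary.Lattice.Structures using (IsLattice)
open import Relation.Binary.PropositionalEquality.Core using (_≡_; _≢_; refl)
open import Relation.Nullary.Construct.Add.Supremum using (_⁺; ⊤⁺) renaming ([_] to finite)
open import Relation.Nullary.Decidable.Core using (yes; no; ¬?; dec⇒maybe)
open import Relation.Nullary.Negation.Core using (¬_)
open import Relation.Unary using (Pred; Decidable)

-- Dedekind reals (two-sided cuts).

record ℝ : Set₁ where
  field
    Lower Upper     : Pred ℚ 0ℓ
    lower-inhabited : ∃ Lower
    upper-inhabited : ∃ Upper
    lower-closed    : ∀ {p q} → p ℚ.< q → Lower q → Lower p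
    lower-open      : ∀ {p} → Lower p → ∃ λ q → p ℚ.< q × Lower q
    upper-closed    : ∀ {p q} → p ℚ.< q → Upper p → Upper q
    upper-open      : ∀ {q} → Upper q → ∃ λ p → p ℚ.< q × Upper p
    disjoint        : ∀ {q} → Lower q → Upper q → ⊥
    located         : ∀ {p q} → p ℚ.< q → Lower p ⊎ Upper q

infix 4 _≤ᴿ_ _<ᴿ_ _≈ᴿ_

_≤ᴿ_ _<ᴿ_ _≈ᴿ_ : Rel ℝ 0ℓ
x ≤ᴿ y = ∀ {q} → ℝ.Lower x q → ℝ.Lower y q
x <ᴿ y = ∃ λ q → ℝ.Upper x q × ℝ.Lower y q
x ≈ᴿ y = x ≤ᴿ y × y ≤ᴿ x

open AddSupremum _<ᴿ_ public using (_<⁺_)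

record LatticeOrderedMonoid a ℓ₁ ℓ₂ : Set (lsuc (a ⊔ ℓ₁ ⊔ ℓ₂)) where
  infixl 7 _⊕_
  infix  4 _≈_ _≤_
  field
    Carrier   : Set a
    _≈_       : Rel Carrier ℓ₁
    _≤_       : Rel Carrier ℓ₂
    _⊕_       : Op₂ Carrier
    0#        : Carrier
    _∨_ _∧_   : Op₂ Carrier
    isMonoid  : IsMonoid _≈_ _⊕_ 0#
    isLattice : IsLattice _≈_ _≤_ _∨_ _∧_
    ⊕-monoʳ   : ∀ x → (λ y → x ⊕ y) Preserves _≤_ ⟶ _≤_
    ⊕-monoˡ   : ∀ x → (λ y → y ⊕ x) Preserves _≤_ ⟶ _≤_

  open ToStrict _≈_ _≤_ public using (_<_)

  IsLowerBound IsUpperBound IsMeet IsJoin :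
    ∀ {p} → Pred Carrier p → Pred Carrier (a ⊔ ℓ₂ ⊔ p)
  IsLowerBound S b = ∀ {x} → S x → b ≤ x
  IsUpperBound S b = ∀ {x} → S x → x ≤ b
  IsMeet S m = IsLowerBound S m × (∀ {b} → IsLowerBound S b → b ≤ m)
  IsJoin S j = IsUpperBound S j × (∀ {b} → IsUpperBound S b → j ≤ b)

  ConditionallyComplete : Set (lsuc (a ⊔ ℓ₁ ⊔ ℓ₂))
  ConditionallyComplete =
    (S : Pred Carrier (a ⊔ ℓ₁ ⊔ ℓ₂)) → ∃ S →
    ∃ (IsLowerBound S) → ∃ (IsUpperBound S) → ∃ (IsMeet S) × ∃ (IsJoin S)

record Digraph : Set where
  field
    #vertices #arcs : ℕ
    tail head       : Fin #arcs → Fin #vertices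

  Vertex Arc : Set
  Vertex = Fin #vertices
  Arc    = Fin #arcs

  ArcBetween : Rel Vertex 0ℓ
  ArcBetween u v = ∃ λ a → tail a ≡ u × head a ≡ v

  Path : Rel Vertex 0ℓ
  Path = Star ArcBetween

  PathFrom : Vertex → Set
  PathFrom o = ∃ (Path o)

  extensions : ∀ {o v} → Path o v → List (PathFrom o)
  extensions {v = v} P = mapMaybe extend (allFin #arcs)
    where
    extend : Arc → Maybe.Maybe (PathFrom _)
    extend a = Maybe.map (λ tail≡v → head a , P ◅◅ ((a , tail≡v , refl) ◅ ε))
                         (dec⇒maybe (tail a ≟ v))

module Resources {a ℓ₁ ℓ₂} (R : LatticeOrderedMonoid a ℓ₁ ℓ₂) (D : Digraph)
                 (x : Digraph.Arc D → LatticeOrderedMonoid.Carrier R) where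

  open LatticeOrderedMonoid R
  open Digraph D

  resource : ∀ {u v} → Path u v → Carrier
  resource ε       = 0#
  resource (e ◅ P) = x (proj₁ e) ⊕ resource P

  NonnegativeCycles : Set ℓ₂
  NonnegativeCycles = ∀ {v} (C : Path v v) → C ≢ ε → 0# ≤ resource C

  _Dominates_ : ∀ {u v} → Rel (Path u v) ℓ₂
  P Dominates Q = resource P ≤ resource Q

module ShortestPath {a ℓ₁ ℓ₂} (R : LatticeOrderedMonoid a ℓ₁ ℓ₂) (D : Digraph)
                    (x : Digraph.Arc D → LatticeOrderedMonoid.Carrier R)
                    (c : LatticeOrderedMonoid.Carrier R → ℝ)
                    (ρ : LatticeOrderedMonoid.Carrier R → Fin 2)
                    (o d : Digraph.Vertex D) where

  open LatticeOrderedMonoid R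
  open Digraph D
  open Resources R D x

  cost : ∀ {u v} → Path u v → ℝ
  cost P = c (resource P)

  Feasible : ∀ {u v} → Path u v → Set
  Feasible P = ρ (resource P) ≡ zero

  Optimal : Path o d → Set
  Optimal P = Feasible P × (∀ (Q : Path o d) → Feasible Q → cost P ≤ᴿ cost Q)

  NonDominated : Path o d → Set (ℓ₁ ⊔ ℓ₂)
  NonDominated P = ¬ ∃ λ (Q : Path o d) → resource Q < resource P

  Labels : Set
  Labels = (v : Vertex) → List (Path o v)

  _[_]≔_ : Labels → (v : Vertex) → List (Path o v) → Labels
  (M [ v ]≔ Ps) w with v ≟ w
  ... | yes refl = Ps
  ... | no  _    = M w

  record State : Set₁ where
    constructor ⟨_,_,_⟩
    field
      L   : List (PathFrom o)
      cUB : ℝ ⁺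
      M   : Labels

  initial : State
  initial = ⟨ [ o , ε ] , ⊤⁺ , (λ _ → []) ⟩

  HasMinimumKey : PathFrom o → List (PathFrom o) → Set
  HasMinimumKey (_ , P) = All (λ (_ , Q) → cost P ≤ᴿ cost Q)

  Improves : PathFrom o → ℝ ⁺ → Set₁
  Improves (v , P) cUB = v ≡ d × Feasible P × finite (cost P) <⁺ cUB

  PassesDominanceTest : ∀ {v} → Path o v → Labels → Set ℓ₂
  PassesDominanceTest {v} P M = ¬ Any (_Dominates P) (M v)

  -- One iteration.  The relation is nondeterministic in the choice of the
  -- extracted path among those of minimum key.  The decision procedures in
  -- `extend` are there only so that `filter` applies: what it returns does
  -- not depend on them.
  data _⟶_ : State → State → Set (lsuc 0ℓ ⊔ ℓ₂) where

    update : ∀ {L cUB M v} {P : Path o v}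
      (P∈L : (v , P) ∈ L) → HasMinimumKey (v , P) L →
      Improves (v , P) cUB →
      ⟨ L , cUB , M ⟩ ⟶ ⟨ L ─ P∈L , finite (cost P) , M ⟩

    extend : ∀ {L cUB M v} {P : Path o v}
      (P∈L : (v , P) ∈ L) → HasMinimumKey (v , P) L →
      ¬ Improves (v , P) cUB →
      PassesDominanceTest P M →
      (dominated? : Decidable (P Dominates_)) →
      let dominated = map (v ,_) (filter dominated? (M v)) in
      (removed? : Decidable (_∈ dominated)) →
      ⟨ L , cUB , M ⟩ ⟶
      ⟨ extensions P ++ filter (λ Q → ¬? (removed? Q)) (L ─ P∈L)
      , cUB
      , M [ v ]≔ (P ∷ filter (λ Q → ¬? (dominated? Q)) (M v)) ⟩

    discard : ∀ {L cUB M v} {P : Path o v}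
      (P∈L : (v , P) ∈ L) → HasMinimumKey (v , P) L →
      ¬ Improves (v , P) cUB →
      ¬ PassesDominanceTest P M →
      ⟨ L , cUB , M ⟩ ⟶ ⟨ L ─ P∈L , cUB , M ⟩

  -- Every execution from the state reaches an empty L after finitely many
  -- iterations; in particular none gets stuck while L is nonempty.
  data Terminates (s : State) : Set (lsuc 0ℓ ⊔ ℓ₂) where
    done : State.L s ≡ [] → Terminates s
    next : ∃ (s ⟶_) → (∀ {t} → s ⟶ t → Terminates t) → Terminates s

  CorrectOutput : ℝ ⁺ → Set (lsuc 0ℓ ⊔ ℓ₁ ⊔ ℓ₂)
  CorrectOutput cUB =
    (∀ {r} → cUB ≡ finite r → ∃ λ P → Optimal P × NonDominated P × r ≈ᴿ cost P) ×
    (cUB ≡ ⊤⁺ → ¬ ∃ λ (P : Path o d) → Feasible P)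

{-# OPTIONS --safe #-}

-- Termination: once an extended path is a label at a vertex, a label below it stays there, so a path
-- returning to that vertex along a cycle, of resource ≥ 0, fails the dominance test.  Hence only
-- elementary paths are extended.
-- Optimality: as long as some feasible path Q is cheaper than the bound, L contains a path with a
-- completion dominating Q.  When such a path is discarded because of a label, the completion carries
-- over to the label, whose extensions have left in L a path with a strictly shorter completion.
-- Non-dominated solutions: removing cycles replaces each path by an elementary path dominating it,
-- so below an optimal path there is one of minimal resource, and it is optimal by isotony.

module Submission where

open import Defs
open import Level using (Level; _⊔_; 0ℓ; Lift; lift; lower) renaming (suc to lsuc)
open import Algebra.Properties.CommutativeSemigroup using (x∙yz≈y∙xz)
open import Algebra.Structures using (IsMonoid)
open import Axiom.ExcludedMiddle using (ExcludedMiddle)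
open import Data.Fin.Base as Fin using (Fin; zero)
open import Data.Fin.Properties using (_≟_; injective⇒≤)
import Data.Fin.Properties as Fin
open import Data.List.Base
  using (List; []; _∷_; [_]; _++_; _∷ʳ_; map; filter; concatMap; length; lookup; allFin; upTo)
open import Data.List.Membership.Propositional using (_∈_; _∉_; lose; find)
open import Data.List.Membership.Propositional.Properties
  using (∈-++⁺ˡ; ∈-++⁺ʳ; ∈-map⁺; ∈-map⁻; ∈-filter⁺; ∈-filter⁻;
         ∈-concatMap⁺; ∈-allFin; ∈-upTo⁺; ∈-lookup)
open import Data.List.Properties using (length-mapMaybe; length-tabulate; map-++)
open import Data.List.Relation.Unary.All as All using (All; []; _∷_)
import Data.List.Relation.Unary.All.Properties as All
open import Data.List.Relation.Unary.AllPairs using ([]; _∷_)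
open import Data.List.Relation.Unary.Any as Any using (Any; here; there; _─_)
import Data.List.Relation.Unary.Any.Properties as Any
open import Data.List.Relation.Unary.Unique.Propositional using (Unique)
open import Data.List.Relation.Unary.Unique.Propositional.Properties
  using (++⁺; Unique[x∷xs]⇒x∉xs)
import Data.Maybe.Base as Maybe
import Data.Maybe.Relation.Unary.All as MaybeAll
import Data.Maybe.Relation.Unary.Any as MaybeAny
open import Data.Nat.Base as ℕ using (ℕ; zero; suc; _+_; _*_; _∸_; s≤s)
open import Data.Nat.Induction using (<-wellFounded)
open import Data.Nat.ListAction using (sum)
open import Data.Nat.ListAction.Properties using (sum-++)
import Data.Nat.Properties as ℕ
open import Data.Product.Base as Product using (∃; _×_; _,_; proj₁; proj₂)
import Data.Rational.Properties as ℚ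
open import Data.Sum.Base as Sum using (_⊎_; inj₁; inj₂)
open import Data.Unit.Polymorphic.Base using (⊤)
open import Function.Base using (_∘_; id)
open import Function.Definitions using (Injective)
open import Induction.WellFounded using (Acc; acc)
open import Relation.Binary.Bundles using (Poset)
open import Relation.Binary.Construct.Add.Supremum.NonStrict _≤ᴿ_
  using (_≤⁺_; _≤⊤⁺; ≤⁺-trans) renaming ([_] to finite-mono)
import Relation.Binary.Construct.Add.Supremum.Strict _<ᴿ_ as Strict
import Relation.Binary.Construct.NonStrictToStrict as ToStrict
open import Relation.Binary.Construct.Closure.ReflexiveTransitive using (Star; ε; _◅_; _◅◅_)
open import Relation.Binary.Core using (Rel; _Preserves_⟶_)
import Relation.Binary.Definitions as Binary
open import Relation.Binary.Lattice.Structures using (IsLattice)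
open import Relation.Binary.PropositionalEquality
  using (_≡_; refl; sym; trans; cong; cong₂; subst)
import Relation.Binary.Reasoning.PartialOrder as PosetReasoning
open import Relation.Nullary.Construct.Add.Supremum using (_⁺; ⊤⁺) renaming ([_] to finite)
open import Relation.Nullary.Decidable.Core
  using (Dec; yes; no; map′; ¬?; dec⇒maybe; decidable-stable; _×-dec_)
open import Relation.Nullary.Negation.Core using (¬_; contradiction)
open import Relation.Unary using (Pred; Decidable)

private
  variable
    ℓ ℓ′ : Level
    A : Set ℓ

-- Excluded middle at lower levels; finite lists and their minimal elements.

lowerEM : ∀ b {a} → ExcludedMiddle (a ⊔ b) → ExcludedMiddle a
lowerEM b em {P} = map′ lower lift (em {Lift b P})

∈-─⁻ : ∀ {x y : A} {xs} (x∈xs : x ∈ xs) → y ∈ xs → y ≡ x ⊎ y ∈ (xs ─ x∈xs)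
∈-─⁻ (here refl)  (here refl)  = inj₁ refl
∈-─⁻ (here refl)  (there y∈xs) = inj₂ y∈xs
∈-─⁻ (there x∈xs) (here refl)  = inj₂ (here refl)
∈-─⁻ (there x∈xs) (there y∈xs) = Sum.map₂ there (∈-─⁻ x∈xs y∈xs)

lookup-injective : ∀ {xs : List A} → Unique xs → Injective _≡_ _≡_ (lookup xs)
lookup-injective {xs = x ∷ xs} _ {zero} {zero} _ = refl
lookup-injective {xs = x ∷ xs} u {zero} {Fin.suc j} eq =
  contradiction (subst (_∈ xs) (sym eq) (∈-lookup j)) (Unique[x∷xs]⇒x∉xs u)
lookup-injective {xs = x ∷ xs} u {Fin.suc i} {zero} eq =
  contradiction (subst (_∈ xs) eq (∈-lookup i)) (Unique[x∷xs]⇒x∉xs u)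
lookup-injective {xs = x ∷ xs} (_ ∷ u) {Fin.suc i} {Fin.suc j} eq =
  cong Fin.suc (lookup-injective u eq)

unique⇒length≤ : ∀ {n} {xs : List (Fin n)} → Unique xs → length xs ℕ.≤ n
unique⇒length≤ u = injective⇒≤ (lookup-injective u)

least : {A : Set ℓ} {_≼_ : Rel A ℓ′} → Binary.Transitive _≼_ → Binary.Total _≼_ →
        ∀ x xs → ∃ λ m → m ∈ x ∷ xs × All (m ≼_) (x ∷ xs)
-- Totality applied to `x` and `x` yields reflexivity.
least ≼-trans total x []       = x , here refl , Sum.reduce (total x x) ∷ []
least ≼-trans total x (y ∷ ys) with least ≼-trans total y ys
... | m , m∈ , m≼ with total x m
...   | inj₁ x≼m = x , here refl , Sum.reduce (total x x) ∷ All.map (≼-trans x≼m) m≼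
...   | inj₂ m≼x = m , there m∈ , m≼x ∷ m≼

-- The candidate moves down to `y` whenever `y` lies below it; by transitivity, nothing already
-- ruled out lies below the new candidate. The start `x` need not belong to the list.
minimalBelow : {A : Set ℓ} {_≺_ : Rel A ℓ′} → Binary.Irreflexive _≡_ _≺_ → Binary.Transitive _≺_ →
               Binary.Decidable _≺_ → ∀ x xs →
               ∃ λ m → (m ≡ x ⊎ m ≺ x) × All (λ y → ¬ y ≺ m) xs
minimalBelow irrefl ≺-trans _≺?_ x []       = x , inj₁ refl , []
minimalBelow irrefl ≺-trans _≺?_ x (y ∷ ys)
  with minimalBelow irrefl ≺-trans _≺?_ x ys
... | m , m≼x , minimal with y ≺? m
...   | no  y⊀m = m , m≼x , y⊀m ∷ minimal
...   | yes y≺m = y , inj₂ (Sum.[ (λ { refl → y≺m }) , ≺-trans y≺m ] m≼x)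
                , irrefl refl ∷ All.map (λ z⊀m z≺y → z⊀m (≺-trans z≺y y≺m)) minimal

-- Sums of weights over lists.

module _ {A : Set ℓ} (w : A → ℕ) where

  total : List A → ℕ
  total xs = sum (map w xs)

  total-++ : ∀ xs ys → total (xs ++ ys) ≡ total xs + total ys
  total-++ xs ys = trans (cong sum (map-++ w xs ys)) (sum-++ (map w xs) (map w ys))

  total-─ : ∀ {x xs} (x∈xs : x ∈ xs) → total xs ≡ w x + total (xs ─ x∈xs)
  total-─ (here refl) = refl
  total-─ {x} {y ∷ xs} (there x∈xs) = trans (cong (w y +_) (total-─ x∈xs))
    (x∙yz≈y∙xz ℕ.+-commutativeSemigroup (w y) (w x) (total (xs ─ x∈xs)))

  total-filter : ∀ {P : Pred A ℓ′} (P? : Decidable P) xs → total (filter P? xs) ℕ.≤ total xs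
  total-filter P? []       = ℕ.≤-refl
  total-filter P? (x ∷ xs) with P? x
  ... | yes _ = ℕ.+-monoʳ-≤ (w x) (total-filter P? xs)
  ... | no  _ = ℕ.m≤n⇒m≤o+n (w x) (total-filter P? xs)

  total-constant : ∀ {k xs} → All (λ x → w x ≡ k) xs → total xs ≡ length xs * k
  total-constant []         = refl
  total-constant (eq ∷ eqs) = cong₂ _+_ eq (total-constant eqs)

-- Order on Dedekind reals and on their extension by a top element.

<ᴿ⇒≤ᴿ : ∀ {x y} → x <ᴿ y → x ≤ᴿ y
<ᴿ⇒≤ᴿ {x} {y} (q , x<q , q<y) {p} p<x with ℚ.<-cmp p q
... | Binary.tri< p<q _ _  = ℝ.lower-closed y p<q q<y
... | Binary.tri≈ _ refl _ = q<y
... | Binary.tri> _ _ q<p  = contradiction x<q (ℝ.disjoint x (ℝ.lower-closed x q<p p<x))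

≮ᴿ⇒≥ᴿ : ∀ {x y} → ¬ x <ᴿ y → y ≤ᴿ x
≮ᴿ⇒≥ᴿ {x} {y} x≮y p<y with ℝ.lower-open y p<y
-- Openness leaves room above `p` for locatedness of `x`; its second alternative would make `q` a
-- witness of `x <ᴿ y`.
... | q , p<q , q<y with ℝ.located x p<q
...   | inj₁ p<x = p<x
...   | inj₂ x<q = contradiction (q , x<q , q<y) x≮y

≤ᴿ-total : ExcludedMiddle 0ℓ → Binary.Total _≤ᴿ_
≤ᴿ-total em x y with em {x <ᴿ y}
... | yes x<y = inj₁ (<ᴿ⇒≤ᴿ {x} {y} x<y)
... | no  x≮y = inj₂ (≮ᴿ⇒≥ᴿ {x} {y} x≮y)

<⁺⇒≤⁺ : ∀ {x u} → finite x Strict.<⁺ u → finite x ≤⁺ u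
<⁺⇒≤⁺ {x} {finite y} Strict.[ x<y ] = finite-mono (<ᴿ⇒≤ᴿ {x} {y} x<y)
<⁺⇒≤⁺ Strict.[ _ ]<⊤⁺ = _ ≤⊤⁺

≮⁺⇒≥⁺ : ∀ {x} u → ¬ finite x Strict.<⁺ u → u ≤⁺ finite x
≮⁺⇒≥⁺     ⊤⁺         x≮u = contradiction Strict.[ _ ]<⊤⁺ x≮u
≮⁺⇒≥⁺ {x} (finite y) x≮y = finite-mono (≮ᴿ⇒≥ᴿ {x} {y} (x≮y ∘ Strict.[_]))

-- Paths, their extensions and the enumeration of elementary paths.

module Paths (D : Digraph) where
  open Digraph D

  private
    variable
      t u v : Vertex

  -- The destination is left out, so a path with distinct origins may still end at a vertex it has
  -- visited before.
  origins : Path u v → List Vertex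
  origins ε           = []
  origins {u} (_ ◅ P) = u ∷ origins P

  ∣_∣ : Path u v → ℕ
  ∣ P ∣ = length (origins P)

  infixl 5 _▻_
  _▻_ : Path t u → ArcBetween u v → Path t v
  P ▻ e = P ◅◅ (e ◅ ε)

  origins-▻ : (P : Path t u) (e : ArcBetween u v) → origins (P ▻ e) ≡ origins P ∷ʳ u
  origins-▻ ε       e = refl
  origins-▻ (_ ◅ P) e = cong (_ ∷_) (origins-▻ P e)

  ∣▻∣ : (P : Path t u) (e : ArcBetween u v) → ∣ P ▻ e ∣ ≡ suc ∣ P ∣
  ∣▻∣ ε       e = refl
  ∣▻∣ (_ ◅ P) e = cong suc (∣▻∣ P e)

  unique-origins-▻ : (P : Path t u) (e : ArcBetween u v) →
                     Unique (origins P) → u ∉ origins P → Unique (origins (P ▻ e))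
  unique-origins-▻ P e unique u∉P rewrite origins-▻ P e =
    ++⁺ unique ([] ∷ []) λ { (u∈P , here refl) → u∉P u∈P }

  extensions-All : {Φ : Pred (PathFrom t) ℓ} (P : Path t u) →
                   (∀ {v} (e : ArcBetween u v) → Φ (v , P ▻ e)) → All Φ (extensions P)
  extensions-All {u = u} {Φ = Φ} P Φ-▻ =
    All.mapMaybe⁺ (All.map⁺ (All.universal (λ a → just-arc a (tail a ≟ u)) (allFin #arcs)))
    where
    -- The decision is made an argument so that matching on it reduces the `Maybe` expression.
    just-arc : ∀ a (tail? : Dec (tail a ≡ u)) →
      MaybeAll.All Φ (Maybe.map (λ eq → head a , P ▻ (a , eq , refl)) (dec⇒maybe tail?))
    just-arc a (yes eq) = MaybeAll.just (Φ-▻ (a , eq , refl))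
    just-arc a (no  _)  = MaybeAll.nothing

  ∈-extensions : (P : Path t u) (e : ArcBetween u v) → (v , P ▻ e) ∈ extensions P
  ∈-extensions {u = u} P (a , refl , refl) =
    Any.mapMaybe⁺ _ _ (Any.map⁺ (lose (∈-allFin a) (just-arc (tail a ≟ tail a))))
    where
    just-arc : (tail? : Dec (tail a ≡ tail a)) →
      MaybeAny.Any ((head a , P ▻ (a , refl , refl)) ≡_)
                   (Maybe.map (λ eq → head a , P ▻ (a , eq , refl)) (dec⇒maybe tail?))
    just-arc (yes refl) = MaybeAny.just refl
    just-arc (no  a≢a)  = contradiction refl a≢a

  length-extensions : (P : Path t u) → length (extensions P) ℕ.≤ #arcs
  length-extensions P =
    ℕ.≤-trans (length-mapMaybe _ (allFin #arcs)) (ℕ.≤-reflexive (length-tabulate id))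

  pathsOfLength : ℕ → (u : Vertex) → List (PathFrom u)
  pathsOfLength zero    u = [ u , ε ]
  pathsOfLength (suc k) u =
    concatMap (λ (v , E) → map (Product.map₂ (E ◅◅_)) (pathsOfLength k v))
              (extensions (ε {x = u}))

  ∈-pathsOfLength : (P : Path u v) → (v , P) ∈ pathsOfLength ∣ P ∣ u
  ∈-pathsOfLength ε       = here refl
  ∈-pathsOfLength (e ◅ P) = ∈-concatMap⁺ _
    (lose (∈-extensions ε e) (∈-map⁺ (Product.map₂ ((e ◅ ε) ◅◅_)) (∈-pathsOfLength P)))

  -- A finite superset of the paths with distinct origins. `upTo` excludes its bound, and such a
  -- path can have `#vertices` arcs when it closes up at its end, hence the `suc`.
  elementaryPaths : (u : Vertex) → List (PathFrom u)
  elementaryPaths u = concatMap (λ k → pathsOfLength k u) (upTo (suc #vertices))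

  ∈-elementaryPaths : (P : Path u v) → Unique (origins P) → (v , P) ∈ elementaryPaths u
  ∈-elementaryPaths {u} P unique = ∈-concatMap⁺ (λ k → pathsOfLength k u)
    (lose (∈-upTo⁺ (s≤s (unique⇒length≤ unique))) (∈-pathsOfLength P))

  cutAt : (P : Path t v) → u ∈ origins P → Unique (origins P) →
          ∃ λ (P₁ : Path t u) → ∃ λ (P₂ : Path u v) → P ≡ P₁ ◅◅ P₂ × Unique (origins P₂)
  cutAt (e ◅ P) (here refl) unique       = ε , e ◅ P , refl , unique
  cutAt (e ◅ P) (there u∈P) (_ ∷ unique) with cutAt P u∈P unique
  ... | P₁ , P₂ , refl , unique₂ = e ◅ P₁ , P₂ , refl , unique₂

-- Resources of paths, removal of cycles and minimal dominators.

module Dominance {a ℓ₁ ℓ₂} (R : LatticeOrderedMonoid a ℓ₁ ℓ₂) (D : Digraph)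
                 (x : Digraph.Arc D → LatticeOrderedMonoid.Carrier R)
                 (nonneg : Resources.NonnegativeCycles R D x) where

  open LatticeOrderedMonoid R
  open Digraph D
  open Resources R D x
  open Paths D
  open IsMonoid isMonoid using (assoc; identityˡ; identityʳ; ∙-congˡ)

  poset : Poset a ℓ₁ ℓ₂
  poset = record { isPartialOrder = IsLattice.isPartialOrder isLattice }

  private
    module ≤ = Poset poset
    module ≤-Reasoning = PosetReasoning poset
    variable
      t u v : Vertex

  resource-◅◅ : (P : Path t u) (Q : Path u v) → resource (P ◅◅ Q) ≈ resource P ⊕ resource Q
  resource-◅◅ ε       Q = ≤.Eq.sym (identityˡ _)
  resource-◅◅ (e ◅ P) Q = ≤.Eq.trans (∙-congˡ (resource-◅◅ P Q)) (≤.Eq.sym (assoc _ _ _))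

  -- Lets the first arc of a completion be transferred to the path being completed.
  resource-▻-⊕ : (P : Path t u) (e : ArcBetween u v) (y : Carrier) →
                 resource (P ▻ e) ⊕ y ≤ resource P ⊕ (x (proj₁ e) ⊕ y)
  resource-▻-⊕ P e y = begin
    resource (P ▻ e) ⊕ y                    ≤⟨ ⊕-monoˡ y (≤.reflexive (resource-◅◅ P (e ◅ ε))) ⟩
    resource P ⊕ (x (proj₁ e) ⊕ 0#) ⊕ y     ≈⟨ assoc _ _ _ ⟩
    resource P ⊕ (x (proj₁ e) ⊕ 0# ⊕ y)     ≤⟨ ⊕-monoʳ _ (⊕-monoˡ y (≤.reflexive (identityʳ _))) ⟩
    resource P ⊕ (x (proj₁ e) ⊕ y)          ∎
    where open ≤-Reasoning

  cycle-nonneg : (C : Path v v) → 0# ≤ resource C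
  cycle-nonneg ε       = ≤.refl
  cycle-nonneg (e ◅ C) = nonneg (e ◅ C) λ ()

  -- As `⊕` need not commute, a cycle closing a path and a cycle opening one are treated separately.
  ≤-⊕-cycle : ∀ y (C : Path v v) → y ≤ y ⊕ resource C
  ≤-⊕-cycle y C = ≤.trans (≤.reflexive (≤.Eq.sym (identityʳ y))) (⊕-monoʳ y (cycle-nonneg C))

  ≤-cycle-⊕ : ∀ (C : Path v v) y → y ≤ resource C ⊕ y
  ≤-cycle-⊕ C y = ≤.trans (≤.reflexive (≤.Eq.sym (identityˡ y))) (⊕-monoˡ y (cycle-nonneg C))

  -- The rest of the path is shortened first. If `u` recurs in the result, the arc `e` followed by
  -- the part up to `u` is a cycle at the front, and dropping it does not increase the resource.
  elementaryDominator : (P : Path u v) → ∃ λ (Q : Path u v) → Q Dominates P × Unique (origins Q)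
  elementaryDominator ε = ε , ≤.refl , []
  elementaryDominator {u} (e ◅ P) with elementaryDominator P
  ... | Q , Q≤P , unique with Any.any? (u ≟_) (origins Q)
  ...   | no  u∉Q = e ◅ Q , ⊕-monoʳ _ Q≤P , All.¬Any⇒All¬ _ u∉Q ∷ unique
  ...   | yes u∈Q with cutAt Q u∈Q unique
  ...     | Q₁ , Q₂ , refl , unique₂ = Q₂ , Q₂≤ , unique₂
    where
    open ≤-Reasoning
    Q₂≤ : resource Q₂ ≤ resource (e ◅ P)
    Q₂≤ = begin
      resource Q₂                          ≤⟨ ≤-cycle-⊕ (e ◅ Q₁) _ ⟩
      resource (e ◅ Q₁) ⊕ resource Q₂      ≈⟨ resource-◅◅ (e ◅ Q₁) Q₂ ⟨
      resource (e ◅ (Q₁ ◅◅ Q₂))            ≤⟨ ⊕-monoʳ _ Q≤P ⟩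
      resource (e ◅ P)                     ∎

  -- Minimality among finitely many elementary paths suffices: a path strictly below `Q` has an
  -- elementary dominator, which is strictly below `Q` too.
  minimalDominator : ExcludedMiddle (ℓ₁ ⊔ ℓ₂) → (P : Path u v) → ∃ λ (Q : Path u v) →
                     Q Dominates P × ¬ ∃ λ (Q′ : Path u v) → resource Q′ < resource Q
  minimalDominator {u} {v} em P = dominator
    (minimalBelow ≺-irrefl (λ {i j k} → ≺-trans {i} {j} {k}) (λ _ _ → em)
                  (v , P) (elementaryPaths u))
    where
    -- The enumeration mixes destinations, so only paths with a common one are compared.
    _≺_ : Rel (PathFrom u) (ℓ₁ ⊔ ℓ₂)
    (w₁ , Q₁) ≺ (w₂ , Q₂) = w₁ ≡ w₂ × resource Q₁ < resource Q₂

    ≺-irrefl : Binary.Irreflexive _≡_ _≺_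
    ≺-irrefl refl (_ , _ , x≉x) = x≉x ≤.Eq.refl

    ≺-trans : Binary.Transitive _≺_
    ≺-trans {i = _ , P₁} {_ , P₂} {_ , P₃} (refl , P₁<P₂) (refl , P₂<P₃) = refl ,
      ToStrict.<-trans _≈_ _≤_ ≤.isPartialOrder {resource P₁} {resource P₂} {resource P₃} P₁<P₂ P₂<P₃

    nonDominated : (Q : Path u v) → All (λ Q′ → ¬ Q′ ≺ (v , Q)) (elementaryPaths u) →
                   ¬ ∃ λ (Q′ : Path u v) → resource Q′ < resource Q
    nonDominated Q minimal (Q′ , Q′<Q) with elementaryDominator Q′
    ... | Q″ , Q″≤Q′ , unique = All.lookup minimal (∈-elementaryPaths Q″ unique)
      (refl , ToStrict.≤-<-trans _≈_ _≤_ ≤.trans ≤.antisym ≤.≤-respˡ-≈ Q″≤Q′ Q′<Q)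

    dominator : (∃ λ m → (m ≡ (v , P) ⊎ m ≺ (v , P)) × All (λ Q → ¬ Q ≺ m) (elementaryPaths u)) →
                ∃ λ (Q : Path u v) →
                  Q Dominates P × ¬ ∃ λ (Q′ : Path u v) → resource Q′ < resource Q
    dominator (_ , inj₁ refl , minimal)             = P , ≤.refl , nonDominated P minimal
    dominator ((_ , Q) , inj₂ (refl , Q<P) , minimal) = Q , proj₁ Q<P , nonDominated Q minimal

module Correctness {a ℓ₁ ℓ₂} (R : LatticeOrderedMonoid a ℓ₁ ℓ₂) (D : Digraph)
                   (x : Digraph.Arc D → LatticeOrderedMonoid.Carrier R)
                   (c : LatticeOrderedMonoid.Carrier R → ℝ)
                   (ρ : LatticeOrderedMonoid.Carrier R → Fin 2)
                   (o d : Digraph.Vertex D)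
                   (c-mono : c Preserves (LatticeOrderedMonoid._≤_ R) ⟶ _≤ᴿ_)
                   (ρ-mono : ρ Preserves (LatticeOrderedMonoid._≤_ R) ⟶ Fin._≤_)
                   (nonneg : Resources.NonnegativeCycles R D x) where

  open LatticeOrderedMonoid R
  open Digraph D
  open Resources R D x
  open ShortestPath R D x c ρ o d
  open Paths D
  open Dominance R D x nonneg
  open IsMonoid isMonoid using (assoc; identityˡ; identityʳ)

  private
    module ≤ = Poset poset
    variable
      u v w : Vertex

  -- Labels below a resource and their persistence.

  ρ-antitone : ∀ {y z} → y ≤ z → ρ z ≡ zero → ρ y ≡ zero
  ρ-antitone {y} {z} y≤z ρz≡0 =
    Fin.toℕ-injective (ℕ.n≤0⇒n≡0 (subst (ρ y Fin.≤_) ρz≡0 (ρ-mono y≤z)))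

  -- Phrased for a resource instead of a path, so that it persists when a label gives way to one
  -- dominating it.
  HasLabelBelow : Labels → Vertex → Carrier → Set ℓ₂
  HasLabelBelow M v y = Any (λ P → resource P ≤ y) (M v)

  hasLabelBelow-mono : ∀ {Ps : List (Path o v)} {y z} → y ≤ z →
                       Any (λ P → resource P ≤ y) Ps → Any (λ P → resource P ≤ z) Ps
  hasLabelBelow-mono y≤z = Any.map (λ P≤y → ≤.trans P≤y y≤z)

  -- With offset r, every proper prefix Q of the path has a label below r ⊕ resource Q.
  PrefixesLabelled : Labels → Carrier → Path u v → Set ℓ₂
  PrefixesLabelled     M r ε       = ⊤
  PrefixesLabelled {u} M r (e ◅ P) = HasLabelBelow M u r × PrefixesLabelled M (r ⊕ x (proj₁ e)) P

  prefixesLabelled-map : ∀ {M M′} → (∀ {v y} → HasLabelBelow M v y → HasLabelBelow M′ v y) →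
                         ∀ {r} (P : Path u v) → PrefixesLabelled M r P → PrefixesLabelled M′ r P
  prefixesLabelled-map f ε       _        = _
  prefixesLabelled-map f (e ◅ P) (l , ls) = f l , prefixesLabelled-map f P ls

  prefixesLabelled-▻ : ∀ {M r} (P : Path u v) (e : ArcBetween v w) → PrefixesLabelled M r P →
                       HasLabelBelow M v (r ⊕ resource P) → PrefixesLabelled M r (P ▻ e)
  prefixesLabelled-▻ ε       e _        l  = hasLabelBelow-mono (≤.reflexive (identityʳ _)) l , _
  prefixesLabelled-▻ (f ◅ P) e (l , ls) l′ =
    l , prefixesLabelled-▻ P e ls (hasLabelBelow-mono (≤.reflexive (≤.Eq.sym (assoc _ _ _))) l′)

  -- The prefix reaching the earlier visit of `v` has a label below it, and the rest of `P` is a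
  -- cycle, which can only increase the resource.
  revisit : ∀ {M r} (P : Path u v) → PrefixesLabelled M r P → v ∈ origins P →
            HasLabelBelow M v (r ⊕ resource P)
  revisit (e ◅ P) (l , ls) (here refl) = hasLabelBelow-mono (≤-⊕-cycle _ (e ◅ P)) l
  revisit (e ◅ P) (l , ls) (there v∈P) =
    hasLabelBelow-mono (≤.reflexive (assoc _ _ _)) (revisit P ls v∈P)

  updated : (M : Labels) (Ps : List (Path o v)) → (M [ v ]≔ Ps) v ≡ Ps
  updated {v} M Ps with v ≟ v
  ... | yes refl = refl
  ... | no  v≢v  = contradiction refl v≢v

  module _ (M : Labels) (P : Path o v) (dominated? : Decidable (P Dominates_)) where

    relabelled : Labels
    relabelled = M [ v ]≔ (P ∷ filter (λ Q → ¬? (dominated? Q)) (M v))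

    -- A removed label is dominated by `P`, which takes over its role by transitivity.
    relabelled-⊇ : ∀ {w y} → HasLabelBelow M w y → HasLabelBelow relabelled w y
    relabelled-⊇ {w} l with v ≟ w
    ... | no  _    = l
    ... | yes refl with find l
    ...   | Q , Q∈M , Q≤y with dominated? Q
    ...     | yes P≤Q = here (≤.trans P≤Q Q≤y)
    ...     | no  P≰Q = there (lose (∈-filter⁺ (λ Q → ¬? (dominated? Q)) Q∈M P≰Q) Q≤y)

    relabelled-new : ∀ {y} → resource P ≤ y → HasLabelBelow relabelled v y
    relabelled-new P≤y rewrite updated M (P ∷ filter (λ Q → ¬? (dominated? Q)) (M v)) =
      here P≤y

    ∈-relabelled⁻ : ∀ {w} {Q : Path o w} → Q ∈ relabelled w → (w , Q) ≡ (v , P) ⊎ Q ∈ M w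
    ∈-relabelled⁻ {w} Q∈ with v ≟ w
    ... | no  _    = inj₂ Q∈
    ... | yes refl with Q∈
    ...   | here refl = inj₁ refl
    ...   | there Q∈′ = inj₂ (proj₁ (∈-filter⁻ (λ Q → ¬? (dominated? Q)) Q∈′))

  -- Only elementary paths are extended.

  Generated : Labels → Pred (PathFrom o) ℓ₂
  Generated M (v , P) = PrefixesLabelled M 0# P × Unique (origins P)

  AllGenerated : Pred State ℓ₂
  AllGenerated ⟨ L , _ , M ⟩ = All (Generated M) L

  -- Otherwise the label provided by `revisit` would dominate `P`.
  generated⇒∉ : ∀ {M} {P : Path o v} → Generated M (v , P) → PassesDominanceTest P M → v ∉ origins P
  generated⇒∉ {P = P} (ls , _) passes v∈P =
    passes (hasLabelBelow-mono (≤.reflexive (identityˡ _)) (revisit P ls v∈P))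

  allGenerated-step : ∀ {s t} → s ⟶ t → AllGenerated s → AllGenerated t
  allGenerated-step (update P∈L _ _)    gen = All.─⁺ P∈L gen
  allGenerated-step (discard P∈L _ _ _) gen = All.─⁺ P∈L gen
  allGenerated-step (extend {M = M} {v} {P} P∈L _ _ passes dominated? removed?) gen =
    All.++⁺ (extensions-All P generated-▻)
            (All.filter⁺ (λ Q → ¬? (removed? Q)) (All.map generated-⊇ (All.─⁺ P∈L gen)))
    where
    M′ = relabelled M P dominated?

    generated-⊇ : ∀ {Q} → Generated M Q → Generated M′ Q
    generated-⊇ {w , Q} (ls , unique) =
      prefixesLabelled-map (relabelled-⊇ M P dominated?) Q ls , unique

    generated-▻ : (e : ArcBetween v w) → Generated M′ (w , P ▻ e)
    generated-▻ e with genP@(ls , unique) ← All.lookup gen P∈L =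
      -- The one new proper prefix is `P` itself, which has just become a label.
      prefixesLabelled-▻ P e (proj₁ (generated-⊇ genP))
        (relabelled-new M P dominated? (≤.reflexive (≤.Eq.sym (identityˡ _)))) ,
      unique-origins-▻ P e unique (generated⇒∉ genP passes)

  -- A decreasing measure.

  -- weight k bounds the number of paths of length at most k from a given vertex.
  weight : ℕ → ℕ
  weight zero    = 1
  weight (suc k) = suc (#arcs * weight k)

  weight-positive : ∀ k → 0 ℕ.< weight k
  weight-positive zero    = ℕ.z<s
  weight-positive (suc k) = ℕ.z<s

  -- The difference is the number of arcs that can still be appended while the origins stay
  -- distinct.
  potential : PathFrom o → ℕ
  potential (_ , P) = weight (#vertices ∸ ∣ P ∣)

  measure : State → ℕ
  measure s = total potential (State.L s)

  removal-decreases : ∀ {L} {P : PathFrom o} (P∈L : P ∈ L) →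
                      total potential (L ─ P∈L) ℕ.< total potential L
  removal-decreases {L} {P} P∈L rewrite total-─ potential P∈L =
    ℕ.m<n+m _ (weight-positive (#vertices ∸ ∣ proj₂ P ∣))

  -- In the recursion of `weight`, the product pays for at most `#arcs` extensions, and the `suc`
  -- makes the inequality strict.
  extensions-decrease : (P : Path o v) → Unique (origins P) → v ∉ origins P →
                        total potential (extensions P) ℕ.< potential (v , P)
  extensions-decrease {v} P unique v∉P = begin-strict
    total potential (extensions P)
      ≡⟨ total-constant potential
           (extensions-All P (λ e → cong (λ k → weight (#vertices ∸ k)) (∣▻∣ P e))) ⟩
    length (extensions P) * W            ≤⟨ ℕ.*-monoˡ-≤ W (length-extensions P) ⟩
    #arcs * W                            <⟨ ℕ.n<1+n _ ⟩
    weight (suc (#vertices ∸ suc ∣ P ∣)) ≡⟨ cong weight (ℕ.+-∸-assoc 1 P<n) ⟨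
    weight (suc #vertices ∸ suc ∣ P ∣)   ∎
    where
    open ℕ.≤-Reasoning
    W = weight (#vertices ∸ suc ∣ P ∣)
    P<n : suc ∣ P ∣ ℕ.≤ #vertices
    -- The destination is a further distinct vertex, so the truncated subtraction is exact.
    P<n = unique⇒length≤ (All.¬Any⇒All¬ _ v∉P ∷ unique)

  measure-decreases : ∀ {s t} → AllGenerated s → s ⟶ t → measure t ℕ.< measure s
  measure-decreases gen (update P∈L _ _)    = removal-decreases P∈L
  measure-decreases gen (discard P∈L _ _ _) = removal-decreases P∈L
  measure-decreases gen (extend {L} {P = P} P∈L _ _ passes dominated? removed?)
    rewrite total-─ potential P∈L
          | total-++ potential (extensions P) (filter (λ Q → ¬? (removed? Q)) (L ─ P∈L)) =
    ℕ.+-mono-<-≤ (extensions-decrease P (proj₂ genP) (generated⇒∉ genP passes))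
                 (total-filter potential (λ Q → ¬? (removed? Q)) (L ─ P∈L))
    where genP = All.lookup gen P∈L

  -- Progress and termination.

  module _ (em₀ : ExcludedMiddle 0ℓ) (em₂ : ExcludedMiddle ℓ₂) where

    improves? : ∀ P cUB → Dec (Improves P cUB)
    improves? (v , P) cUB = (v ≟ d) ×-dec (ρ (resource P) ≟ zero) ×-dec finite<⁺? cUB
      where
      finite<⁺? : ∀ u → Dec (finite (cost P) <⁺ u)
      finite<⁺? = Strict.<⁺-dec (λ _ _ → em₀) (finite (cost P))

    progress : ∀ P L cUB M → ∃ (⟨ P ∷ L , cUB , M ⟩ ⟶_)
    progress P L cUB M with least {_≼_ = _≼_} (λ P≤Q Q≤R p → Q≤R (P≤Q p)) ≼-total P L
      where
      _≼_ : Rel (PathFrom o) 0ℓ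
      (_ , P) ≼ (_ , Q) = cost P ≤ᴿ cost Q
      ≼-total : Binary.Total _≼_
      ≼-total (_ , P) (_ , Q) = ≤ᴿ-total em₀ (cost P) (cost Q)
    ... | Q , Q∈L , Q≤L with improves? Q cUB
    ...   | yes improves = _ , update Q∈L Q≤L improves
    ...   | no ¬improves with em₂ {PassesDominanceTest (proj₂ Q) M}
    ...     | yes passes = _ , extend Q∈L Q≤L ¬improves passes (λ _ → em₂) (λ _ → em₀)
    ...     | no  fails  = _ , discard Q∈L Q≤L ¬improves fails

    terminates : ∀ s → Acc ℕ._<_ (measure s) → AllGenerated s → Terminates s
    terminates ⟨ []    , _   , _ ⟩ _         _   = done refl
    terminates ⟨ P ∷ L , cUB , M ⟩ (acc rec) gen =
      next (progress P L cUB M) λ {t} step →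
        terminates t (rec (measure-decreases gen step)) (allGenerated-step step gen)

    initial-terminates : Terminates initial
    initial-terminates = terminates initial (<-wellFounded _) ((_ , []) ∷ [])

  -- Coverage of feasible solutions by the bound or by `L`.

  _≤cost_ : ℝ ⁺ → Carrier → Set₁
  cUB ≤cost y = cUB ≤⁺ finite (c y)

  ≤cost-mono : ∀ {cUB y z} → y ≤ z → cUB ≤cost y → cUB ≤cost z
  ≤cost-mono y≤z cUB≤ = ≤⁺-trans (λ p q r → q (p r)) cUB≤ (finite-mono (c-mono y≤z))

  -- Here `y` is a resource that the output has to match. It need not come from one fixed path,
  -- since a path may be replaced by one dominating it. The strict bound `k` serves as the recursion
  -- measure in `discard-covered`.
  Covered : State → Carrier → ℕ → Set (lsuc 0ℓ ⊔ ℓ₂)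
  Covered ⟨ L , cUB , _ ⟩ y k = cUB ≤cost y ⊎
    ∃ λ v → ∃ λ (P : Path o v) → ∃ λ (Q : Path v d) →
      (v , P) ∈ L × ∣ Q ∣ ℕ.< k × resource P ⊕ resource Q ≤ y

  covered-mono : ∀ s {y z j k} → y ≤ z → j ℕ.≤ k → Covered s y j → Covered s z k
  covered-mono s y≤z j≤k (inj₁ cUB≤y) = inj₁ (≤cost-mono y≤z cUB≤y)
  covered-mono s y≤z j≤k (inj₂ (v , P , Q , P∈L , Q<j , PQ≤y)) =
    inj₂ (v , P , Q , P∈L , ℕ.<-≤-trans Q<j j≤k , ≤.trans PQ≤y y≤z)

  -- The bound on the length of the new completion makes replacing a discarded path
  -- by its dominating label well-founded.
  LabelsCovered : State → Set (lsuc 0ℓ ⊔ ℓ₂)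
  LabelsCovered s = ∀ {v} {P : Path o v} → P ∈ State.M s v → (Q : Path v d) →
    ρ (resource P ⊕ resource Q) ≡ zero → Covered s (resource P ⊕ resource Q) ∣ Q ∣

  module _ {L cUB M} {P : Path o v} {P∈L : (v , P) ∈ L} (min : HasMinimumKey (v , P) L)
           (¬improves : ¬ Improves (v , P) cUB) (passes : PassesDominanceTest P M)
           (dominated? : Decidable (P Dominates_))
           (removed? : Decidable (_∈ map {B = PathFrom o} (v ,_) (filter dominated? (M v)))) where

    private
      L′ = extensions P ++ filter (λ Q → ¬? (removed? Q)) (L ─ P∈L)
      t = ⟨ L′ , cUB , relabelled M P dominated? ⟩

    -- With an empty completion, `P` is itself feasible and ends at `d`, so its failure to improve
    -- bounds `cUB` by its cost. Otherwise an extension of `P` absorbs the first arc, which makes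
    -- the completion strictly shorter.
    extended-covered : ∀ {y k} (Q : Path v d) → ρ y ≡ zero → resource P ⊕ resource Q ≤ y →
                       ∣ Q ∣ ℕ.≤ k → Covered t y k
    extended-covered ε ρy≡0 P≤y _ = inj₁ (≤cost-mono P≤y′ (≮⁺⇒≥⁺ cUB λ cP<cUB →
        ¬improves (refl , ρ-antitone P≤y′ ρy≡0 , cP<cUB)))
      where P≤y′ = ≤.trans (≤.reflexive (≤.Eq.sym (identityʳ _))) P≤y
    extended-covered (e ◅ Q) ρy≡0 PQ≤y Q<k =
      inj₂ (_ , P ▻ e , Q , ∈-++⁺ˡ (∈-extensions P e) , Q<k , ≤.trans (resource-▻-⊕ P e _) PQ≤y)

    extend-covered : ∀ {y k} → ρ y ≡ zero → Covered ⟨ L , cUB , M ⟩ y k → Covered t y k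
    extend-covered ρy≡0 (inj₁ cUB≤y) = inj₁ cUB≤y
    extend-covered ρy≡0 (inj₂ (w , P′ , Q , P′∈L , Q<k , P′Q≤y)) with ∈-─⁻ P∈L P′∈L
    ... | inj₁ refl = extended-covered Q ρy≡0 P′Q≤y (ℕ.<⇒≤ Q<k)
    ... | inj₂ P′∈ with removed? (w , P′)
    ...   | no  P′-kept = inj₂ (w , P′ , Q ,
              ∈-++⁺ʳ (extensions P) (∈-filter⁺ (λ Q → ¬? (removed? Q)) P′∈ P′-kept) , Q<k , P′Q≤y)
    -- A removed path is dominated by `P`, so its completion is handed over to `P`.
    ...   | yes P′-removed with ∈-map⁻ (v ,_) P′-removed
    ...     | _ , P′-dominated , refl = extended-covered Q ρy≡0
      (≤.trans (⊕-monoˡ _ (proj₂ (∈-filter⁻ dominated? {xs = M v} P′-dominated))) P′Q≤y) (ℕ.<⇒≤ Q<k)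

    extend-labelsCovered : LabelsCovered ⟨ L , cUB , M ⟩ → LabelsCovered t
    extend-labelsCovered labels P′∈M Q ρ≡0 with ∈-relabelled⁻ M P dominated? P′∈M
    ... | inj₁ refl = extended-covered Q ρ≡0 ≤.refl ℕ.≤-refl
    ... | inj₂ P′∈M = extend-covered ρ≡0 (labels P′∈M Q ρ≡0)

  update-covered : ∀ {L cUB M} {P : Path o v} (P∈L : (v , P) ∈ L) → Improves (v , P) cUB →
                   ∀ {y k} → Covered ⟨ L , cUB , M ⟩ y k →
                   Covered ⟨ L ─ P∈L , finite (cost P) , M ⟩ y k
  update-covered P∈L (_ , _ , cP<cUB) (inj₁ cUB≤y) =
    inj₁ (≤⁺-trans (λ p q r → q (p r)) (<⁺⇒≤⁺ cP<cUB) cUB≤y)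
  update-covered P∈L (refl , _) (inj₂ (w , P′ , Q , P′∈L , Q<k , P′Q≤y)) with ∈-─⁻ P∈L P′∈L
  -- The extracted path ends at `d` and is not extended: its completion is closed, of resource at
  -- least `0#`, so the new bound already accounts for `y`.
  ... | inj₁ refl = inj₁ (finite-mono (c-mono (≤.trans (≤-⊕-cycle _ Q) P′Q≤y)))
  ... | inj₂ P′∈  = inj₂ (w , P′ , Q , P′∈ , Q<k , P′Q≤y)

  -- Coverage of the dominating label may lead back to the discarded path, but with a shorter
  -- completion; the replacement is therefore iterated, by recursion on `k`.
  discard-covered : ∀ {L cUB M} {P : Path o v} (P∈L : (v , P) ∈ L) →
                    HasLabelBelow M v (resource P) → LabelsCovered ⟨ L , cUB , M ⟩ →
                    ∀ k {y} → ρ y ≡ zero → Covered ⟨ L , cUB , M ⟩ y k →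
                    Covered ⟨ L ─ P∈L , cUB , M ⟩ y k
  discard-covered P∈L label labels k ρy≡0 (inj₁ cUB≤y) = inj₁ cUB≤y
  discard-covered {L = L} {cUB} {M} P∈L label labels (suc k) ρy≡0
                  (inj₂ (w , P′ , Q , P′∈L , s≤s Q≤k , P′Q≤y))
    with ∈-─⁻ P∈L P′∈L
  ... | inj₂ P′∈  = inj₂ (w , P′ , Q , P′∈ , s≤s Q≤k , P′Q≤y)
  ... | inj₁ refl with find label
  ...   | P″ , P″∈M , P″≤P = covered-mono t P″Q≤y (ℕ.n≤1+n k)
          (discard-covered P∈L label labels k ρ≡0
            (covered-mono s ≤.refl Q≤k (labels P″∈M Q ρ≡0)))
    where
    s = ⟨ L , cUB , M ⟩
    t = ⟨ L ─ P∈L , cUB , M ⟩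
    P″Q≤y = ≤.trans (⊕-monoˡ _ P″≤P) P′Q≤y
    ρ≡0 = ρ-antitone P″Q≤y ρy≡0

  -- The invariant along a run.

  record Invariant (s : State) : Set (lsuc 0ℓ ⊔ ℓ₂) where
    field
      labelsCovered : LabelsCovered s
      -- The `suc` admits `Q` itself as completion of the initial empty path.
      pathsCovered  : (Q : Path o d) → Feasible Q → Covered s (resource Q) (suc ∣ Q ∣)
      attained      : ∀ {r} → State.cUB s ≡ finite r → ∃ λ (P : Path o d) → Feasible P × r ≡ cost P

  open Invariant

  initial-invariant : Invariant initial
  initial-invariant .labelsCovered ()
  initial-invariant .pathsCovered Q _ =
    inj₂ (o , ε , Q , here refl , ℕ.≤-refl , ≤.reflexive (identityˡ _))
  initial-invariant .attained ()

  step-invariant : ExcludedMiddle ℓ₂ → ∀ {s t} → s ⟶ t → Invariant s → Invariant t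
  step-invariant em (update {M = M} {P = P} P∈L _ improves@(refl , feasible , _)) inv = record
    { labelsCovered = λ P∈M Q ρ≡0 → update-covered {M = M} P∈L improves (labelsCovered inv P∈M Q ρ≡0)
    ; pathsCovered  = λ Q ρ≡0 → update-covered {M = M} P∈L improves (pathsCovered inv Q ρ≡0)
    ; attained      = λ { refl → P , feasible , refl }
    }
  step-invariant em (extend {M = M} P∈L min ¬improves passes dominated? removed?) inv = record
    { labelsCovered = extend-labelsCovered {M = M} min ¬improves passes dominated? removed? (labelsCovered inv)
    ; pathsCovered  = λ Q ρ≡0 →
        extend-covered {M = M} min ¬improves passes dominated? removed? ρ≡0 (pathsCovered inv Q ρ≡0)
    ; attained      = attained inv
    }
  step-invariant em (discard P∈L _ _ fails) inv = record
    { labelsCovered = λ P∈M Q ρ≡0 →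
        discard-covered P∈L label (labelsCovered inv) _ ρ≡0 (labelsCovered inv P∈M Q ρ≡0)
    ; pathsCovered  = λ Q ρ≡0 →
        discard-covered P∈L label (labelsCovered inv) _ ρ≡0 (pathsCovered inv Q ρ≡0)
    ; attained      = attained inv
    }
    -- Failing the test is a double negation; excluded middle extracts a dominating label.
    where label = decidable-stable em fails

  run-invariant : ExcludedMiddle ℓ₂ → ∀ {s t} → Star _⟶_ s t → Invariant s → Invariant t
  run-invariant em ε              inv = inv
  run-invariant em (step ◅ steps) inv = run-invariant em steps (step-invariant em step inv)

  -- Correctness of the output.

  optimal⇒output : ExcludedMiddle (ℓ₁ ⊔ ℓ₂) → ∀ {P : Path o d} → Optimal P →
                   ∃ λ Q → Optimal Q × NonDominated Q × cost P ≈ᴿ cost Q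
  optimal⇒output em {P} (feasible , P≤) with minimalDominator em P
  ... | Q , Q≤P , nonDominated =
    Q , (feasibleQ , λ Q′ feasible′ p → P≤ Q′ feasible′ (c-mono Q≤P p)) ,
    nonDominated , P≤ Q feasibleQ , c-mono Q≤P
    where feasibleQ = ρ-antitone Q≤P feasible

  -- An empty `L` leaves only the first alternative of `Covered`.
  final-bound : ∀ {s} → Invariant s → State.L s ≡ [] → (Q : Path o d) → Feasible Q →
                State.cUB s ≤cost resource Q
  final-bound inv refl Q feasible with pathsCovered inv Q feasible
  ... | inj₁ cUB≤Q = cUB≤Q
  ... | inj₂ (_ , _ , _ , () , _)

  correctOutput : ExcludedMiddle (ℓ₁ ⊔ ℓ₂) → ∀ {s} → Invariant s → State.L s ≡ [] →
                  CorrectOutput (State.cUB s)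
  correctOutput em {s} inv L≡[] = finiteBound , infiniteBound
    where
    finiteBound : ∀ {r} → State.cUB s ≡ finite r →
                  ∃ λ P → Optimal P × NonDominated P × r ≈ᴿ cost P
    finiteBound {r} eq with attained inv eq
    ... | P , feasible , refl = optimal⇒output em {P} (feasible , λ Q feasibleQ →
      finite-cancel (subst (_≤cost resource Q) eq (final-bound inv L≡[] Q feasibleQ)))
      where
      finite-cancel : ∀ {x y} → finite x ≤⁺ finite y → x ≤ᴿ y
      finite-cancel (finite-mono x≤y) = x≤y

    infiniteBound : State.cUB s ≡ ⊤⁺ → ¬ ∃ λ (P : Path o d) → Feasible P
    infiniteBound eq (P , feasible)
      with subst (_≤cost resource P) eq (final-bound inv L≡[] P feasible)
    ... | ()

theorem6 :
  ∀ {a ℓ₁ ℓ₂} → ExcludedMiddle (a ⊔ ℓ₁ ⊔ ℓ₂) →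
  (R : LatticeOrderedMonoid a ℓ₁ ℓ₂) (D : Digraph) →
  let open LatticeOrderedMonoid R
      open Digraph D in
  ConditionallyComplete →
  (o d : Vertex) (x : Arc → Carrier) (c : Carrier → ℝ) (ρ : Carrier → Fin 2) →
  c Preserves _≤_ ⟶ _≤ᴿ_ →
  ρ Preserves _≤_ ⟶ Fin._≤_ →
  let open Resources R D x
      open ShortestPath R D x c ρ o d in
  NonnegativeCycles →
  Terminates initial ×
  (∀ {s} → Star _⟶_ initial s → State.L s ≡ [] → CorrectOutput (State.cUB s))
theorem6 {a} {ℓ₁} {ℓ₂} em R D _ o d x c ρ c-mono ρ-mono nonneg =
  initial-terminates (lowerEM (a ⊔ ℓ₁ ⊔ ℓ₂) em) em₂ ,
  λ run → correctOutput (lowerEM (a ⊔ ℓ₁ ⊔ ℓ₂) em) (run-invariant em₂ run initial-invariant)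
  where
  open Correctness R D x c ρ o d c-mono ρ-mono nonneg
  em₂ : ExcludedMiddle ℓ₂
  em₂ = lowerEM (a ⊔ ℓ₁ ⊔ ℓ₂) em
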